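{- Let $c_0$ be a proper $4$-colouring of the plane, let $\mu$ be a left-invariant finitely additive probability measure on $S_4\times E(2)$, and let $p_d$ be the associated monochromaticity probabilities (see context). Let $d>0$ be fixed, and take $5$ different points in the plane such that among the $10$ distances between pairs of them at least $8$ are equal to $1$ or $d$. Let $n$ denote the number of pairs at distance $d$. (i) If exactly two pairs have distance not in $\{1,d\}$, and these distances are $x\le y$, then $p_d\ge \frac{1-p_x-p_y}{n}$. (ii) If exactly one pair has distance not in $\{1,d\}$, and this distance is $x$, then $p_d\ge\frac{1-p_x}{n}$. (iii) If no pair has distance outside $\{1,d\}$, then $p_d\ge \frac1n$.
   Context: Identify the plane with $\mathbb C$. A proper $4$-colouring of the plane is a map $c_0:\mathbb C\to\{1,2,3,4\}$ such that no two points at distance $1$ have the same colour. Let $S_4$ be the group of permutations of the colours and $E(2)$ the group of Euclidean isometries of the plane. The group $S_4\times E(2)$ is amenable, so there is a finitely additive probability measure $\mu$ defined on all subsets of $S_4\times E(2)$ which is left-invariant, i.e. $\mu(gE)=\mu(E)$ for all $g\in S_4\times E(2)$ and $E\subseteq S_4\times E(2)$. For $(\sigma,T)\in S_4\times E(2)$ consider the (random) colouring $c=\sigma\circ c_0\circ T^{ -1}$. For $d\ge 0$, $p_d$ denotes the probability that two points $A,B$ at distance $d$ get the same colour: $p_d=\mu(\{(\sigma,T): c(A)=c(B)\})$; by left-invariance this does not depend on the choice of $A,B$ with $|AB|=d$. The existence of $c_0$ is a standing assumption, and $c_0,\mu$ are arbitrary but fixed. -}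

module Defs where

open import Algebra.Bundles using (CommutativeRing; Group)
import Algebra.Construct.DirectProduct as DirectProduct
import Algebra.Properties.Semiring.Mult as Mult
import Algebra.Solver.Ring.NaturalCoefficients.Default as Solver
open import Data.Empty using (⊥-elim)
open import Data.Fin.Base using (Fin)
import Data.Fin.Properties as Fin
open import Data.List.Base using (List; allFin; cartesianProduct; filter; length; map)
open import Data.Nat.Base using (ℕ; zero; suc; NonZero; ≢-nonZero⁻¹)
open import Data.Product.Base using (∃; ∃-syntax; _×_; _,_; proj₁; proj₂)
open import Data.Product.Relation.Binary.Pointwise.NonDependent using (×-setoid)
open import Data.Sum.Base using (_⊎_; inj₁; inj₂)
open import Data.Unit.Base using (⊤; tt)
open import Function.Bundles using (Func; Inverse)
import Function.Construct.Composition as Composition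
import Function.Construct.Identity as Identity
import Function.Construct.Symmetry as Symmetry
open import Level using (0ℓ)
open import Relation.Binary.Bundles using (Setoid; DecTotalOrder)
open import Relation.Binary.Core using (Rel)
open import Relation.Binary.Definitions using (_Respects_)
import Relation.Binary.Properties.DecTotalOrder as DecTotalOrderProperties
import Relation.Binary.Reasoning.Setoid as SetoidReasoning
open import Relation.Binary.PropositionalEquality as ≡ using (_≡_; _≢_)
open import Relation.Binary.Structures using (IsDecTotalOrder)
open import Relation.Nullary using (¬_; yes; no)
open import Relation.Nullary.Decidable using (_⊎-dec_; ¬?)
open import Relation.Unary using (Pred; _≐_; Decidable)

------------------------------------------------------------------------
-- The real numbers

-- The (classical) real numbers, given by their categorical axioms: a
-- Dedekind-complete ordered field.  Decidability of the order is part
-- of the classical theory; equality is a setoid equality, so that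
-- quotient constructions of the reals are covered.

record RealNumbers : Set₁ where
  infix 4 _≤_
  field
    commutativeRing : CommutativeRing 0ℓ 0ℓ

  open CommutativeRing commutativeRing public
    renaming (Carrier to ℝ; setoid to ℝ-setoid)

  field
    _≤_             : Rel ℝ 0ℓ
    isDecTotalOrder : IsDecTotalOrder _≈_ _≤_
    0≉1             : 0# ≉ 1#
    +-monoˡ-≤       : ∀ z {x y} → x ≤ y → x + z ≤ y + z
    *-nonNegative   : ∀ {x y} → 0# ≤ x → 0# ≤ y → 0# ≤ x * y
    invertible      : ∀ x → x ≉ 0# → ∃[ y ] x * y ≈ 1#

  UpperBound : Pred ℝ 0ℓ → Pred ℝ 0ℓ
  UpperBound S b = ∀ {x} → S x → x ≤ b

  field
    supremum : ∀ (S : Pred ℝ 0ℓ) → ∃ S → ∃ (UpperBound S) →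
               ∃[ s ] UpperBound S s × (∀ {b} → UpperBound S b → s ≤ b)

  ≤-decTotalOrder : DecTotalOrder 0ℓ 0ℓ 0ℓ
  ≤-decTotalOrder = record { isDecTotalOrder = isDecTotalOrder }

  open DecTotalOrder ≤-decTotalOrder public
    using (_≟_; _≤?_; total; antisym; ≤-respˡ-≈; ≤-respʳ-≈)
    renaming (refl to ≤-refl; reflexive to ≤-reflexive; trans to ≤-trans)

  open DecTotalOrderProperties ≤-decTotalOrder public
    using (_<_; <⇒≉; <⇒≱; ≰⇒>; ≤∧≉⇒<)

------------------------------------------------------------------------
-- Division by natural numbers and square roots

module RealArithmetic (R : RealNumbers) where
  open RealNumbers R hiding (zero)
  open Mult semiring using () renaming (_×_ to _·_)
  open Solver commutativeSemiring

  private
    difference : ∀ {x y} → x ≤ y → ∃[ k ] 0# ≤ k × y ≈ x + k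
    difference {x} {y} x≤y = y - x
      , ≤-respˡ-≈ (-‿inverseʳ x) (+-monoˡ-≤ (- x) x≤y)
      , (begin
          y              ≈⟨ +-identityʳ y ⟨
          y + 0#         ≈⟨ +-congˡ (-‿inverseˡ x) ⟨
          y + (- x + x)  ≈⟨ +-assoc y (- x) x ⟨
          y - x + x      ≈⟨ +-comm (y - x) x ⟩
          x + (y - x)    ∎)
      where open SetoidReasoning ℝ-setoid

    x≤x+k : ∀ {x k} → 0# ≤ k → x ≤ x + k
    x≤x+k {x} {k} 0≤k =
      ≤-respʳ-≈ (+-comm k x) (≤-respˡ-≈ (+-identityˡ x) (+-monoˡ-≤ x 0≤k))

    +-nonNegative : ∀ {x y} → 0# ≤ x → 0# ≤ y → 0# ≤ x + y
    +-nonNegative 0≤x 0≤y = ≤-trans 0≤x (x≤x+k 0≤y)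

    +-cancel-≤ : ∀ {x k} → x + k ≤ x → k ≤ 0#
    +-cancel-≤ {x} {k} x+k≤x =
      ≤-respʳ-≈ (-‿inverseʳ x) (≤-respˡ-≈ eq (+-monoˡ-≤ (- x) x+k≤x))
      where
      open SetoidReasoning ℝ-setoid
      eq : x + k - x ≈ k
      eq = begin
        x + k - x    ≈⟨ +-congʳ (+-comm x k) ⟩
        k + x - x    ≈⟨ +-assoc k x (- x) ⟩
        k + (x - x)  ≈⟨ +-congˡ (-‿inverseʳ x) ⟩
        k + 0#       ≈⟨ +-identityʳ k ⟩
        k            ∎

  *-monoˡ-≤ : ∀ {z x y} → 0# ≤ z → x ≤ y → z * x ≤ z * y
  *-monoˡ-≤ {z} {x} {y} 0≤z x≤y with difference x≤y
  ... | k , 0≤k , y≈x+k =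
    ≤-respʳ-≈ (sym (trans (*-congˡ y≈x+k) (distribˡ z x k)))
              (x≤x+k (*-nonNegative 0≤z 0≤k))

  square-nonNegative : ∀ x → 0# ≤ x * x
  square-nonNegative x with total 0# x
  ... | inj₁ 0≤x = *-nonNegative 0≤x 0≤x
  ... | inj₂ x≤0 with difference x≤0
  ...   | k , 0≤k , 0≈x+k = ≤-respʳ-≈ k²≈x² (*-nonNegative 0≤k 0≤k)
    where
    open SetoidReasoning ℝ-setoid
    k²≈x² : k * k ≈ x * x
    k²≈x² = begin
      k * k                ≈⟨ +-identityʳ _ ⟨
      k * k + 0#           ≈⟨ +-congˡ (zeroʳ x) ⟨
      k * k + x * 0#       ≈⟨ +-congˡ (*-congˡ 0≈x+k) ⟩
      k * k + x * (x + k)  ≈⟨ solve 2 (λ k x → k :* k :+ x :* (x :+ k) := x :* x :+ (x :+ k) :* k) refl k x ⟩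
      x * x + (x + k) * k  ≈⟨ +-congˡ (*-congʳ 0≈x+k) ⟨
      x * x + 0# * k       ≈⟨ +-congˡ (zeroˡ k) ⟩
      x * x + 0#           ≈⟨ +-identityʳ _ ⟩
      x * x                ∎

  sumOfSquares-nonNegative : ∀ x y → 0# ≤ x * x + y * y
  sumOfSquares-nonNegative x y =
    +-nonNegative (square-nonNegative x) (square-nonNegative y)

  private
    0≤1 : 0# ≤ 1#
    0≤1 = ≤-respʳ-≈ (*-identityˡ 1#) (square-nonNegative 1#)

    1≰0 : ¬ 1# ≤ 0#
    1≰0 1≤0 = 0≉1 (antisym 0≤1 1≤0)

    inverse-nonNegative : ∀ {x y} → 0# ≤ x → x * y ≈ 1# → 0# ≤ y
    inverse-nonNegative {x} {y} 0≤x xy≈1 with total 0# y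
    ... | inj₁ 0≤y = 0≤y
    ... | inj₂ y≤0 =
      ⊥-elim (1≰0 (≤-respˡ-≈ xy≈1 (≤-respʳ-≈ (zeroʳ x) (*-monoˡ-≤ 0≤x y≤0))))

    1+k≉0 : ∀ {k} → 0# ≤ k → 1# + k ≉ 0#
    1+k≉0 0≤k eq = 1≰0 (≤-respʳ-≈ eq (x≤x+k 0≤k))

  fromℕ : ℕ → ℝ
  fromℕ n = n · 1#

  fromℕ-nonNegative : ∀ n → 0# ≤ fromℕ n
  fromℕ-nonNegative zero    = ≤-refl
  fromℕ-nonNegative (suc n) = +-nonNegative 0≤1 (fromℕ-nonNegative n)

  fromℕ≉0 : ∀ n .{{_ : NonZero n}} → fromℕ n ≉ 0#
  fromℕ≉0 zero    = ⊥-elim (≢-nonZero⁻¹ zero ≡.refl)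
  fromℕ≉0 (suc n) = 1+k≉0 (fromℕ-nonNegative n)

  infixl 7 _/_
  _/_ : ℝ → (n : ℕ) .{{_ : NonZero n}} → ℝ
  x / n = x * proj₁ (invertible (fromℕ n) (fromℕ≉0 n))

  private
    sqrt-unique : ∀ {x y} → 0# ≤ x → 0# ≤ y → x ≤ y → x * x ≈ y * y → x ≈ y
    sqrt-unique {x} {y} 0≤x 0≤y x≤y x²≈y² with difference x≤y
    ... | k , 0≤k , y≈x+k with k ≟ 0#
    ...   | yes k≈0 = sym (trans y≈x+k (trans (+-congˡ k≈0) (+-identityʳ x)))
    ...   | no  k≉0 = ⊥-elim (k≉0 k≈0)
      where
      open SetoidReasoning ℝ-setoid
      expand : y * y ≈ x * x + (k * k + (x + x) * k)
      expand = trans (*-cong y≈x+k y≈x+k)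
        (solve 2 (λ x k → (x :+ k) :* (x :+ k) := x :* x :+ (k :* k :+ (x :+ x) :* k)) refl x k)
      k²≤0 : k * k ≤ 0#
      k²≤0 = ≤-trans (x≤x+k (*-nonNegative (+-nonNegative 0≤x 0≤x) 0≤k))
                     (+-cancel-≤ (≤-reflexive (sym (trans x²≈y² expand))))
      i : ℝ
      i = proj₁ (invertible k k≉0)
      k≈0 : k ≈ 0#
      k≈0 = begin
        k            ≈⟨ *-identityʳ k ⟨
        k * 1#       ≈⟨ *-congˡ (proj₂ (invertible k k≉0)) ⟨
        k * (k * i)  ≈⟨ *-assoc k k i ⟨
        k * k * i    ≈⟨ *-congʳ (antisym k²≤0 (square-nonNegative k)) ⟩
        0# * i       ≈⟨ zeroˡ i ⟩
        0#           ∎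

  √-unique : ∀ {x y} → 0# ≤ x → 0# ≤ y → x * x ≈ y * y → x ≈ y
  √-unique {x} {y} 0≤x 0≤y x²≈y² with total x y
  ... | inj₁ x≤y = sqrt-unique 0≤x 0≤y x≤y x²≈y²
  ... | inj₂ y≤x = sym (sqrt-unique 0≤y 0≤x y≤x (sym x²≈y²))

  √-exists : ∀ a → 0# ≤ a → ∃[ s ] 0# ≤ s × s * s ≈ a
  √-exists a 0≤a = s , 0≤s , antisym s²≤a a≤s²
    where
    open SetoidReasoning ℝ-setoid

    S : Pred ℝ 0ℓ
    S x = 0# ≤ x × x * x ≤ a

    0∈S : S 0#
    0∈S = ≤-refl , ≤-respˡ-≈ (sym (zeroˡ 0#)) 0≤a

    bounded : UpperBound S (1# + a)
    bounded {x} (0≤x , x²≤a) with total x 1#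
    ... | inj₁ x≤1 = ≤-trans x≤1 (x≤x+k 0≤a)
    ... | inj₂ 1≤x = ≤-trans (≤-respˡ-≈ (*-identityʳ x) (*-monoˡ-≤ 0≤x 1≤x))
                     (≤-trans x²≤a (≤-respʳ-≈ (+-comm a 1#) (x≤x+k 0≤1)))

    sup : ∃[ s ] UpperBound S s × (∀ {b} → UpperBound S b → s ≤ b)
    sup = supremum S (0# , 0∈S) (1# + a , bounded)

    s : ℝ
    s = proj₁ sup

    upper : UpperBound S s
    upper = proj₁ (proj₂ sup)

    least : ∀ {b} → UpperBound S b → s ≤ b
    least = proj₂ (proj₂ sup)

    0≤s : 0# ≤ s
    0≤s = upper 0∈S

    -- If s² < a, then s + δ / (2s + 1 + δ) ∈ S, where δ = a - s².
    a≤s² : a ≤ s * s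
    a≤s² with total a (s * s)
    ... | inj₁ a≤s² = a≤s²
    ... | inj₂ s²≤a with difference s²≤a
    ...   | δ , 0≤δ , a≈s²+δ =
      ≤-reflexive (trans a≈s²+δ (trans (+-congˡ δ≈0) (+-identityʳ _)))
      where
      2s = s + s
      D  = 1# + (2s + δ)
      0≤2s : 0# ≤ 2s
      0≤2s = +-nonNegative 0≤s 0≤s
      0≤D : 0# ≤ D
      0≤D = +-nonNegative 0≤1 (+-nonNegative 0≤2s 0≤δ)
      inv = invertible D (1+k≉0 (+-nonNegative 0≤2s 0≤δ))
      i = proj₁ inv
      ε = δ * i
      0≤i : 0# ≤ i
      0≤i = inverse-nonNegative 0≤D (proj₂ inv)
      0≤ε : 0# ≤ ε
      0≤ε = *-nonNegative 0≤δ 0≤i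
      Dε≈δ : D * ε ≈ δ
      Dε≈δ = begin
        D * (δ * i)  ≈⟨ solve 3 (λ D δ i → D :* (δ :* i) := δ :* (D :* i)) refl D δ i ⟩
        δ * (D * i)  ≈⟨ *-congˡ (proj₂ inv) ⟩
        δ * 1#       ≈⟨ *-identityʳ δ ⟩
        δ            ∎
      ε≤1 : ε ≤ 1#
      ε≤1 = ≤-respˡ-≈ (*-comm i δ) (≤-respʳ-≈ (trans (*-comm i D) (proj₂ inv))
        (*-monoˡ-≤ 0≤i (≤-respʳ-≈
          (solve 2 (λ t δ → δ :+ (con 1 :+ t) := con 1 :+ (t :+ δ)) refl 2s δ)
          (x≤x+k (+-nonNegative 0≤1 0≤2s)))))
      -- (s + ε)² = s² + 2sε + εε ≤ s² + 2sε + ε + δε = s² + Dε = a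
      inS : (s + ε) * (s + ε) ≤ a
      inS = ≤-trans
        (≤-respˡ-≈
          (solve 2 (λ s ε → ε :* ε :+ (s :* s :+ (s :+ s) :* ε) := (s :+ ε) :* (s :+ ε)) refl s ε)
          (+-monoˡ-≤ (s * s + 2s * ε) (≤-respʳ-≈ (*-identityʳ ε) (*-monoˡ-≤ 0≤ε ε≤1))))
        (≤-respʳ-≈
          (begin
            ε + (s * s + 2s * ε) + δ * ε
              ≈⟨ solve 3 (λ s δ ε → ε :+ (s :* s :+ (s :+ s) :* ε) :+ δ :* ε
                   := s :* s :+ (con 1 :+ ((s :+ s) :+ δ)) :* ε) refl s δ ε ⟩
            s * s + D * ε  ≈⟨ +-congˡ Dε≈δ ⟩
            s * s + δ      ≈⟨ a≈s²+δ ⟨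
            a              ∎)
          (x≤x+k (*-nonNegative 0≤δ 0≤ε)))
      ε≈0 : ε ≈ 0#
      ε≈0 = antisym (+-cancel-≤ (upper (+-nonNegative 0≤s 0≤ε , inS))) 0≤ε
      δ≈0 : δ ≈ 0#
      δ≈0 = trans (sym Dε≈δ) (trans (*-congˡ ε≈0) (zeroʳ D))

    -- If s² > a, then s - δ / 2s is an upper bound of S, where δ = s² - a.
    s²≤a : s * s ≤ a
    s²≤a with total (s * s) a
    ... | inj₁ s²≤a = s²≤a
    ... | inj₂ a≤s² with difference a≤s² | (s + s) ≟ 0#
    ...   | δ , 0≤δ , s²≈a+δ | yes 2s≈0 =
      ≤-respˡ-≈ (sym (trans (*-congˡ s≈0) (zeroʳ s))) 0≤a
      where
      s≈0 : s ≈ 0#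
      s≈0 = antisym (≤-respʳ-≈ 2s≈0 (x≤x+k 0≤s)) 0≤s
    ...   | δ , 0≤δ , s²≈a+δ | no 2s≉0 =
      ≤-reflexive (trans s²≈a+δ (trans (+-congˡ δ≈0) (+-identityʳ a)))
      where
      2s  = s + s
      inv = invertible 2s 2s≉0
      i   = proj₁ inv
      ε   = δ * i
      0≤i : 0# ≤ i
      0≤i = inverse-nonNegative (+-nonNegative 0≤s 0≤s) (proj₂ inv)
      0≤ε : 0# ≤ ε
      0≤ε = *-nonNegative 0≤δ 0≤i
      2sε≈δ : 2s * ε ≈ δ
      2sε≈δ = begin
        2s * (δ * i)  ≈⟨ solve 3 (λ t δ i → t :* (δ :* i) := δ :* (t :* i)) refl 2s δ i ⟩
        δ * (2s * i)  ≈⟨ *-congˡ (proj₂ inv) ⟩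
        δ * 1#        ≈⟨ *-identityʳ δ ⟩
        δ             ∎
      2sx≤s²+x² : ∀ x → 2s * x ≤ s * s + x * x
      2sx≤s²+x² x with total x s
      ... | inj₁ x≤s with difference x≤s
      ...   | k , _ , s≈x+k = ≤-respʳ-≈ eq (x≤x+k (square-nonNegative k))
        where
        eq : 2s * x + k * k ≈ s * s + x * x
        eq = begin
          2s * x + k * k
            ≈⟨ +-congʳ (*-congʳ (+-cong s≈x+k s≈x+k)) ⟩
          ((x + k) + (x + k)) * x + k * k
            ≈⟨ solve 2 (λ x k → ((x :+ k) :+ (x :+ k)) :* x :+ k :* k
                 := (x :+ k) :* (x :+ k) :+ x :* x) refl x k ⟩
          (x + k) * (x + k) + x * x
            ≈⟨ +-congʳ (*-cong s≈x+k s≈x+k) ⟨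
          s * s + x * x  ∎
      2sx≤s²+x² x | inj₂ s≤x with difference s≤x
      ...   | k , _ , x≈s+k = ≤-respʳ-≈ eq (x≤x+k (square-nonNegative k))
        where
        eq : 2s * x + k * k ≈ s * s + x * x
        eq = begin
          2s * x + k * k
            ≈⟨ +-congʳ (*-congˡ x≈s+k) ⟩
          2s * (s + k) + k * k
            ≈⟨ solve 2 (λ s k → (s :+ s) :* (s :+ k) :+ k :* k
                 := s :* s :+ (s :+ k) :* (s :+ k)) refl s k ⟩
          s * s + (s + k) * (s + k)
            ≈⟨ +-congˡ (*-cong x≈s+k x≈s+k) ⟨
          s * s + x * x  ∎
      -- 2s(x + ε) = 2sx + δ ≤ s² + x² + δ ≤ s² + a + δ = 2s²
      bound : ∀ {x} → S x → x + ε ≤ s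
      bound {x} (_ , x²≤a) = ≤-respˡ-≈ (cancel (x + ε)) (≤-respʳ-≈ (cancel s) (*-monoˡ-≤ 0≤i
        (≤-respˡ-≈ (sym (trans (distribˡ 2s x ε) (+-congˡ 2sε≈δ)))
          (≤-trans (+-monoˡ-≤ δ (2sx≤s²+x² x))
            (≤-respˡ-≈
              (solve 3 (λ u v w → u :+ (v :+ w) := v :+ u :+ w) refl (x * x) (s * s) δ)
              (≤-respʳ-≈ 2s²-eq (+-monoˡ-≤ (s * s + δ) x²≤a)))))))
        where
        cancel : ∀ z → i * (2s * z) ≈ z
        cancel z = begin
          i * (2s * z)  ≈⟨ solve 3 (λ i t z → i :* (t :* z) := t :* i :* z) refl i 2s z ⟩
          2s * i * z    ≈⟨ *-congʳ (proj₂ inv) ⟩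
          1# * z        ≈⟨ *-identityˡ z ⟩
          z             ∎
        2s²-eq : a + (s * s + δ) ≈ 2s * s
        2s²-eq = begin
          a + (s * s + δ)  ≈⟨ solve 3 (λ a t δ → a :+ (t :+ δ) := t :+ (a :+ δ)) refl a (s * s) δ ⟩
          s * s + (a + δ)  ≈⟨ +-congˡ s²≈a+δ ⟨
          s * s + s * s    ≈⟨ distribʳ s s s ⟨
          2s * s           ∎
      upper′ : UpperBound S (s - ε)
      upper′ {x} x∈S = ≤-respˡ-≈ eq (+-monoˡ-≤ (- ε) (bound x∈S))
        where
        eq : x + ε - ε ≈ x
        eq = trans (+-assoc x ε (- ε)) (trans (+-congˡ (-‿inverseʳ ε)) (+-identityʳ x))
      ε≤0 : ε ≤ 0#
      ε≤0 = +-cancel-≤ (≤-respʳ-≈ eq (+-monoˡ-≤ ε (least upper′)))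
        where
        eq : s - ε + ε ≈ s
        eq = trans (+-assoc s (- ε) ε) (trans (+-congˡ (-‿inverseˡ ε)) (+-identityʳ s))
      δ≈0 : δ ≈ 0#
      δ≈0 = trans (sym 2sε≈δ) (trans (*-congˡ (antisym ε≤0 0≤ε)) (zeroʳ 2s))

  abstract
    √ : ∀ a → 0# ≤ a → ℝ
    √ a 0≤a = proj₁ (√-exists a 0≤a)

    √-nonNegative : ∀ a (0≤a : 0# ≤ a) → 0# ≤ √ a 0≤a
    √-nonNegative a 0≤a = proj₁ (proj₂ (√-exists a 0≤a))

    √-square : ∀ a (0≤a : 0# ≤ a) → √ a 0≤a * √ a 0≤a ≈ a
    √-square a 0≤a = proj₂ (proj₂ (√-exists a 0≤a))

------------------------------------------------------------------------
-- The Euclidean plane and its isometries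

module Plane (R : RealNumbers) where
  open RealNumbers R
  open RealArithmetic R

  ℂ-setoid : Setoid 0ℓ 0ℓ
  ℂ-setoid = ×-setoid ℝ-setoid ℝ-setoid

  module ℂ = Setoid ℂ-setoid

  Point : Set
  Point = ℂ.Carrier

  dist : Point → Point → ℝ
  dist (x₁ , y₁) (x₂ , y₂) =
    √ ((x₁ - x₂) * (x₁ - x₂) + (y₁ - y₂) * (y₁ - y₂))
      (sumOfSquares-nonNegative (x₁ - x₂) (y₁ - y₂))

  dist-cong : ∀ {A A′ B B′} → A ℂ.≈ A′ → B ℂ.≈ B′ → dist A B ≈ dist A′ B′
  dist-cong (x , y) (x′ , y′) = √-unique (√-nonNegative _ _) (√-nonNegative _ _)
    (trans (√-square _ _) (trans (+-cong (*-cong u u) (*-cong v v)) (sym (√-square _ _))))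
    where
    u = +-cong x (-‿cong x′)
    v = +-cong y (-‿cong y′)

  record Isometry : Set where
    field
      bijection : Inverse ℂ-setoid ℂ-setoid
    open Inverse bijection public
    field
      isometric : ∀ A B → dist (to A) (to B) ≈ dist A B

  -- The Euclidean group; the product T ∙ U is the composite T ∘ U.
  E2 : Group 0ℓ 0ℓ
  E2 = record
    { Carrier = Isometry
    ; _≈_     = λ T U → ∀ A → to T A ℂ.≈ to U A
    ; _∙_     = λ T U → record
      { bijection = Composition.inverse (bijection U) (bijection T)
      ; isometric = λ A B → trans (isometric T (to U A) (to U B)) (isometric U A B)
      }
    ; ε       = record
      { bijection = Identity.inverse ℂ-setoid
      ; isometric = λ A B → refl
      }
    ; _⁻¹     = λ T → record
      { bijection = Symmetry.inverse (bijection T)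
      ; isometric = λ A B → trans (sym (isometric T (from T A) (from T B)))
                                  (dist-cong (strictlyInverseˡ T A) (strictlyInverseˡ T B))
      }
    ; isGroup = record
      { isMonoid = record
        { isSemigroup = record
          { isMagma = record
            { isEquivalence = record
              { refl  = λ A → ℂ.refl
              ; sym   = λ T≈U A → ℂ.sym (T≈U A)
              ; trans = λ T≈U U≈V A → ℂ.trans (T≈U A) (U≈V A)
              }
            ; ∙-cong = λ {T} {T′} {U} {U′} T≈T′ U≈U′ A →
                ℂ.trans (to-cong T (U≈U′ A)) (T≈T′ (to U′ A))
            }
          ; assoc = λ T U V A → ℂ.refl
          }
        ; identity = (λ T A → ℂ.refl) , (λ T A → ℂ.refl)
        }
      ; inverse = strictlyInverseʳ , strictlyInverseˡ
      ; ⁻¹-cong = λ {T} {U} T≈U A → inverseʳ T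
          (ℂ.trans (ℂ.sym (strictlyInverseˡ U A)) (ℂ.sym (T≈U (from U A))))
      }
    }
    where open Isometry

------------------------------------------------------------------------
-- The symmetric group

-- The product σ ∙ τ is the composite σ ∘ τ.
SymmetricGroup : ℕ → Group 0ℓ 0ℓ
SymmetricGroup k = record
  { Carrier = Inverse Fin-setoid Fin-setoid
  ; _≈_     = λ σ τ → ∀ i → to σ i ≡ to τ i
  ; _∙_     = λ σ τ → Composition.inverse τ σ
  ; ε       = Identity.inverse Fin-setoid
  ; _⁻¹     = Symmetry.inverse
  ; isGroup = record
    { isMonoid = record
      { isSemigroup = record
        { isMagma = record
          { isEquivalence = record
            { refl  = λ i → ≡.refl
            ; sym   = λ σ≈τ i → ≡.sym (σ≈τ i)
            ; trans = λ σ≈τ τ≈υ i → ≡.trans (σ≈τ i) (τ≈υ i)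
            }
          ; ∙-cong = λ {σ} {σ′} {τ} {τ′} σ≈σ′ τ≈τ′ i →
              ≡.trans (to-cong σ (τ≈τ′ i)) (σ≈σ′ (to τ′ i))
          }
        ; assoc = λ σ τ υ i → ≡.refl
        }
      ; identity = (λ σ i → ≡.refl) , (λ σ i → ≡.refl)
      }
    ; inverse = strictlyInverseʳ , strictlyInverseˡ
    ; ⁻¹-cong = λ {σ} {τ} σ≈τ i → inverseʳ σ
        (≡.trans (≡.sym (strictlyInverseˡ τ i)) (≡.sym (σ≈τ (from τ i))))
    }
  }
  where
  open Inverse
  Fin-setoid = ≡.setoid (Fin k)

------------------------------------------------------------------------
-- Invariant finitely additive probability measures

-- Subsets of a setoid are predicates that respect its equality.
record Subset (S : Setoid 0ℓ 0ℓ) : Set₁ where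
  open Setoid S
  field
    member   : Pred Carrier 0ℓ
    respects : member Respects _≈_

open Subset public

module _ {S : Setoid 0ℓ 0ℓ} where

  infix 4 _≋_
  _≋_ : Rel (Subset S) 0ℓ
  E ≋ F = member E ≐ member F

  full : Subset S
  full = record { member = λ _ → ⊤ ; respects = λ _ _ → tt }

  infixr 6 _∪_
  _∪_ : Subset S → Subset S → Subset S
  E ∪ F = record
    { member   = λ x → member E x ⊎ member F x
    ; respects = λ { x≈y (inj₁ x∈E) → inj₁ (respects E x≈y x∈E)
                   ; x≈y (inj₂ x∈F) → inj₂ (respects F x≈y x∈F) }
    }

  Disjoint : Rel (Subset S) 0ℓ
  Disjoint E F = ∀ x → ¬ (member E x × member F x)

module _ (G : Group 0ℓ 0ℓ) where
  open Group G

  leftTranslate : Carrier → Subset setoid → Subset setoid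
  leftTranslate g E = record
    { member   = λ x → ∃[ h ] member E h × x ≈ g ∙ h
    ; respects = λ { x≈y (h , h∈E , x≈gh) → h , h∈E , trans (sym x≈y) x≈gh }
    }

record LeftInvariantProbability (R : RealNumbers) (G : Group 0ℓ 0ℓ) : Set₁ where
  open RealNumbers R using (ℝ; _≈_; _≤_; _+_; 0#; 1#)
  open Group G using (Carrier; setoid)
  field
    measure       : Subset setoid → ℝ
    cong          : ∀ {E F} → E ≋ F → measure E ≈ measure F
    nonNegative   : ∀ E → 0# ≤ measure E
    normalised    : measure full ≈ 1#
    additive      : ∀ {E F} → Disjoint E F → measure (E ∪ F) ≈ measure E + measure F
    leftInvariant : ∀ (g : Carrier) E → measure (leftTranslate G g E) ≈ measure E

------------------------------------------------------------------------
-- Random colourings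

module Colouring (R : RealNumbers) where
  open RealNumbers R
  open Plane R

  record ProperColouring (k : ℕ) : Set where
    field
      colouring : Func ℂ-setoid (≡.setoid (Fin k))
    open Func colouring public renaming (to to colour; cong to colour-cong)
    field
      proper : ∀ {A B} → dist A B ≈ 1# → colour A ≢ colour B

  S₄×E2 : Group 0ℓ 0ℓ
  S₄×E2 = DirectProduct.group (SymmetricGroup 4) E2

  module Monochromaticity (c₀ : ProperColouring 4)
                          (μ : LeftInvariantProbability R S₄×E2) where
    open ProperColouring c₀ using (colour; colour-cong)
    open LeftInvariantProbability μ using (measure)
    private module G = Group S₄×E2

    randomColour : G.Carrier → Point → Fin 4
    randomColour (σ , T) A = Inverse.to σ (colour (Isometry.from T A))

    sameColour : Point → Point → Subset G.setoid
    sameColour A B = record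
      { member   = λ g → randomColour g A ≡ randomColour g B
      ; respects = λ {g} {h} g≈h gA≡gB →
          ≡.trans (≡.sym (randomColour-cong {g} {h} g≈h A))
                  (≡.trans gA≡gB (randomColour-cong {g} {h} g≈h B))
      }
      where
      randomColour-cong : ∀ {g h} → g G.≈ h → ∀ A → randomColour g A ≡ randomColour h A
      randomColour-cong {σ , T} {τ , U} (σ≈τ , T≈U) A = ≡.trans
        (σ≈τ (colour (Isometry.from T A)))
        (≡.cong (Inverse.to τ) (colour-cong (Group.⁻¹-cong E2 {T} {U} T≈U A)))

    -- By invariance every pair of points at distance d gives the same
    -- value; the pair 0, d is used here.  Only d ≥ 0 is meaningful.
    p : ℝ → ℝ
    p d = measure (sameColour (0# , 0#) (d , 0#))

------------------------------------------------------------------------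
-- Distances between pairs of points in a finite configuration

module Configuration (R : RealNumbers) (d : RealNumbers.ℝ R)
                     {m : ℕ} (P : Fin m → Plane.Point R) where
  open RealNumbers R
  open Plane R

  Pair : Set
  Pair = Fin m × Fin m

  pairs : List Pair
  pairs = filter (λ (i , j) → i Fin.<? j) (cartesianProduct (allFin m) (allFin m))

  pairDist : Pair → ℝ
  pairDist (i , j) = dist (P i) (P j)

  Distinct : Set
  Distinct = ∀ {i j} → P i ℂ.≈ P j → i ≡ j

  HasDistance-d : Pred Pair 0ℓ
  HasDistance-d e = pairDist e ≈ d

  HasDistance-1-or-d : Pred Pair 0ℓ
  HasDistance-1-or-d e = pairDist e ≈ 1# ⊎ pairDist e ≈ d

  hasDistance-d? : Decidable HasDistance-d
  hasDistance-d? e = pairDist e ≟ d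

  hasDistance-1-or-d? : Decidable HasDistance-1-or-d
  hasDistance-1-or-d? e = (pairDist e ≟ 1#) ⊎-dec (pairDist e ≟ d)

  pairsAt-d : ℕ
  pairsAt-d = length (filter hasDistance-d? pairs)

  pairsAt-1-or-d : ℕ
  pairsAt-1-or-d = length (filter hasDistance-1-or-d? pairs)

  -- The distances not in {1, d}, listed with multiplicity.
  otherDistances : List ℝ
  otherDistances = map pairDist (filter (λ e → ¬? (hasDistance-1-or-d? e)) pairs)

{-# OPTIONS --safe #-}

-- The random colouring uses four colours, so some two of the five points always agree, and the
-- union bound gives 1 ≤ Σ μ(c(A) = c(B)) over the ten pairs.  A pair at distance r contributes
-- p r, by invariance under an isometry carrying it to 0, r; unit pairs contribute 0 because c₀
-- is proper.  For n ≠ 0: if no pair were at distance d, at most two of the ten pairs would fail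
-- to be at unit distance.  Two pairs always avoid the edges of some complete bipartite K₂,₃ on
-- the five points, so two distinct unit circles would meet in three points.

module Submission where

open import Defs
open import Algebra.Bundles using (CommutativeRing; Group)
import Algebra.Properties.AbelianGroup as AbelianGroupProperties
import Algebra.Properties.Ring as RingProperties
import Algebra.Properties.Semiring.Mult.TCOptimised as SemiringMult
import Algebra.Solver.Ring as RingSolver
open import Algebra.Solver.Ring.AlmostCommutativeRing
  using (_-Raw-AlmostCommutative⟶_; fromCommutativeRing)
open import Data.Empty using (⊥-elim)
open import Data.Fin using (#_)
open import Data.Fin.Base as Fin using (Fin)
import Data.Fin.Properties as Fin
open import Data.Integer.Base as ℤ using (ℤ; +_; -[1+_]; _⊖_; _◃_; ∣_∣; sign)
import Data.Integer.Properties as ℤ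
open import Data.List.Base
  using (List; []; _∷_; foldr; map; length; filter; allFin; cartesianProduct)
open import Data.List.Membership.Propositional using (_∈_; find; lose)
open import Data.List.Membership.Propositional.Properties
  using (∈-allFin; ∈-cartesianProduct⁺; ∈-filter⁺; ∈-filter⁻)
open import Data.List.Properties using (map-∘)
import Data.List.Relation.Binary.Permutation.Setoid as Permutation
import Data.List.Relation.Binary.Permutation.Setoid.Properties as PermutationProperties
open import Data.List.Relation.Unary.All as All using (All; []; _∷_; all?; lookup)
open import Data.List.Relation.Unary.AllPairs using ([]; _∷_)
open import Data.List.Relation.Unary.Any as Any using (Any; here; there; any?)
open import Data.List.Relation.Unary.Unique.DecPropositional (Fin._≟_ {5})
  using (Unique; unique?)
open import Data.Maybe.Base using (just; nothing)
open import Data.Nat.Base as ℕ using (ℕ; zero; suc; NonZero; s≤s)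
import Data.Nat.Properties as ℕ
open import Data.Product.Base using (Σ-syntax; ∃-syntax; _×_; _,_; proj₁; proj₂; swap)
open import Data.Product.Properties using (≡-dec)
open import Data.Sign.Base as Sign using (Sign)
open import Data.Sum.Base as Sum using (_⊎_; inj₁; inj₂)
open import Data.Unit.Base using (tt)
open import Function.Base using (_∘_)
open import Function.Bundles using (Injection; Inverse)
open import Function.Properties.Inverse using (Inverse⇒Injection)
open import Level using (0ℓ)
open import Relation.Binary.Core using (Rel)
open import Relation.Binary.Definitions using (WeaklyDecidable; tri<; tri≈; tri>)
open import Relation.Binary.PropositionalEquality as ≡ using (_≡_; _≢_)
import Relation.Binary.Reasoning.Setoid as SetoidReasoning
open import Relation.Nullary using (¬_; Dec; yes; no; contradiction)
open import Relation.Nullary.Decidable using (toWitness; ¬?; _×-dec_; _⊎-dec_)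
open import Relation.Unary using (Decidable; Pred)

-- Integer coefficients for solving ring identities with subtraction

module IntegerCoefficients {c ℓ} (R : CommutativeRing c ℓ) where
  open CommutativeRing R hiding (zero)
  open AbelianGroupProperties +-abelianGroup
    using (ε⁻¹≈ε; ⁻¹-involutive; ⁻¹-∙-comm; xyx⁻¹≈y)
  open RingProperties ring using (-‿distribˡ-*; -‿distribʳ-*)
  open SemiringMult semiring renaming (_×_ to _·_)
  open SetoidReasoning setoid

  fromℤ : ℤ → Carrier
  fromℤ (+ n)    = n · 1#
  fromℤ -[1+ n ] = - (suc n · 1#)

  fromℤ-neg : ∀ i → fromℤ (ℤ.- i) ≈ - fromℤ i
  fromℤ-neg (+ zero)  = sym ε⁻¹≈ε
  fromℤ-neg (+ suc n) = refl
  fromℤ-neg -[1+ n ]  = sym (⁻¹-involutive _)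

  fromℤ-⊖ : ∀ m n → fromℤ (m ⊖ n) ≈ m · 1# - n · 1#
  fromℤ-⊖ m       zero    = sym (trans (+-congˡ ε⁻¹≈ε) (+-identityʳ _))
  fromℤ-⊖ zero    (suc n) = sym (+-identityˡ _)
  fromℤ-⊖ (suc m) (suc n) = begin
    fromℤ (suc m ⊖ suc n)                ≡⟨ ≡.cong fromℤ (ℤ.[1+m]⊖[1+n]≡m⊖n m n) ⟩
    fromℤ (m ⊖ n)                        ≈⟨ fromℤ-⊖ m n ⟩
    m · 1# - n · 1#                      ≈⟨ +-congʳ (xyx⁻¹≈y 1# (m · 1#)) ⟨
    1# + m · 1# - 1# - n · 1#            ≈⟨ +-assoc _ _ _ ⟩
    1# + m · 1# + (- 1# - n · 1#)        ≈⟨ +-congˡ (⁻¹-∙-comm 1# (n · 1#)) ⟩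
    1# + m · 1# - (1# + n · 1#)          ≈⟨ +-cong (1+× m 1#) (-‿cong (1+× n 1#)) ⟨
    suc m · 1# - suc n · 1#              ∎

  fromℤ-+ : ∀ i j → fromℤ (i ℤ.+ j) ≈ fromℤ i + fromℤ j
  fromℤ-+ (+ m)    (+ n)    = ×-homo-+ 1# m n
  fromℤ-+ (+ m)    -[1+ n ] = fromℤ-⊖ m (suc n)
  fromℤ-+ -[1+ m ] (+ n)    = trans (fromℤ-⊖ n (suc m)) (+-comm _ _)
  fromℤ-+ -[1+ m ] -[1+ n ] = begin
    - (suc (suc (m ℕ.+ n)) · 1#)      ≡⟨ ≡.cong (λ k → - (suc k · 1#)) (ℕ.+-suc m n) ⟨
    - ((suc m ℕ.+ suc n) · 1#)        ≈⟨ -‿cong (×-homo-+ 1# (suc m) (suc n)) ⟩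
    - (suc m · 1# + suc n · 1#)       ≈⟨ ⁻¹-∙-comm _ _ ⟨
    - (suc m · 1#) - suc n · 1#       ∎

  signed : Sign → Carrier → Carrier
  signed Sign.+ x = x
  signed Sign.- x = - x

  signed-cong : ∀ s {x y} → x ≈ y → signed s x ≈ signed s y
  signed-cong Sign.+ x≈y = x≈y
  signed-cong Sign.- x≈y = -‿cong x≈y

  signed-* : ∀ s t x y → signed (s Sign.* t) (x * y) ≈ signed s x * signed t y
  signed-* Sign.+ Sign.+ x y = refl
  signed-* Sign.+ Sign.- x y = -‿distribʳ-* x y
  signed-* Sign.- Sign.+ x y = -‿distribˡ-* x y
  signed-* Sign.- Sign.- x y = begin
    x * y          ≈⟨ ⁻¹-involutive _ ⟨
    - - (x * y)    ≈⟨ -‿cong (-‿distribʳ-* x y) ⟩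
    - (x * - y)    ≈⟨ -‿distribˡ-* x (- y) ⟩
    - x * - y      ∎

  fromℤ-◃ : ∀ s n → fromℤ (s ◃ n) ≈ signed s (n · 1#)
  fromℤ-◃ Sign.+ zero    = refl
  fromℤ-◃ Sign.- zero    = sym ε⁻¹≈ε
  fromℤ-◃ Sign.+ (suc n) = refl
  fromℤ-◃ Sign.- (suc n) = refl

  fromℤ-signed : ∀ i → signed (sign i) (∣ i ∣ · 1#) ≈ fromℤ i
  fromℤ-signed (+ n)    = refl
  fromℤ-signed -[1+ n ] = refl

  -- Integer multiplication is defined through signs and absolute values, so the two factors are
  -- compared separately by `signed-*` and `×1-homo-*`.
  fromℤ-* : ∀ i j → fromℤ (i ℤ.* j) ≈ fromℤ i * fromℤ j
  fromℤ-* i j = begin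
    fromℤ (s Sign.* t ◃ m ℕ.* n)           ≈⟨ fromℤ-◃ (s Sign.* t) (m ℕ.* n) ⟩
    signed (s Sign.* t) ((m ℕ.* n) · 1#)   ≈⟨ signed-cong (s Sign.* t) (×1-homo-* m n) ⟩
    signed (s Sign.* t) (m · 1# * n · 1#)  ≈⟨ signed-* s t _ _ ⟩
    signed s (m · 1#) * signed t (n · 1#)  ≈⟨ *-cong (fromℤ-signed i) (fromℤ-signed j) ⟩
    fromℤ i * fromℤ j                      ∎
    where
    s = sign i
    t = sign j
    m = ∣ i ∣
    n = ∣ j ∣

  homomorphism : ℤ.+-*-rawRing -Raw-AlmostCommutative⟶ fromCommutativeRing R
  homomorphism = record
    { ⟦_⟧    = fromℤ
    ; +-homo = fromℤ-+
    ; *-homo = fromℤ-*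
    ; -‿homo = fromℤ-neg
    ; 0-homo = refl
    ; 1-homo = refl
    }

  -- Distinct integers may have equal images in `R`, so inequality of integers yields no verdict.
  coefficient≟ : WeaklyDecidable (λ i j → fromℤ i ≈ fromℤ j)
  coefficient≟ i j with i ℤ.≟ j
  ... | yes i≡j = just (reflexive (≡.cong fromℤ i≡j))
  ... | no  _   = nothing

  open RingSolver ℤ.+-*-rawRing (fromCommutativeRing R) homomorphism coefficient≟ public
    using (solve; con; _:=_; _:+_; _:*_; _:-_; :-_)

-- Cancellation and order in the real field

module OrderedField (R : RealNumbers) where
  open RealNumbers R hiding (zero)
  open RealArithmetic R
  open IntegerCoefficients commutativeRing
  open SetoidReasoning ℝ-setoid

  *-cancelˡ-0 : ∀ {x y} → x ≉ 0# → x * y ≈ 0# → y ≈ 0#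
  *-cancelˡ-0 {x} {y} x≉0 xy≈0 with invertible x x≉0
  ... | i , xi≈1 = begin
    y            ≈⟨ *-identityˡ y ⟨
    1# * y       ≈⟨ *-congʳ xi≈1 ⟨
    x * i * y    ≈⟨ solve 3 (λ x i y → x :* i :* y := i :* (x :* y)) refl x i y ⟩
    i * (x * y)  ≈⟨ *-congˡ xy≈0 ⟩
    i * 0#       ≈⟨ zeroʳ i ⟩
    0#           ∎

  *-cancelˡ : ∀ {x y z} → x ≉ 0# → x * y ≈ x * z → y ≈ z
  *-cancelˡ {x} {y} {z} x≉0 xy≈xz = begin
    y            ≈⟨ solve 2 (λ y z → y := y :- z :+ z) refl y z ⟩
    y - z + z    ≈⟨ +-congʳ (*-cancelˡ-0 x≉0 x[y-z]≈0) ⟩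
    0# + z       ≈⟨ +-identityˡ z ⟩
    z            ∎
    where
    x[y-z]≈0 : x * (y - z) ≈ 0#
    x[y-z]≈0 = begin
      x * (y - z)    ≈⟨ solve 3 (λ x y z → x :* (y :- z) := x :* y :- x :* z) refl x y z ⟩
      x * y - x * z  ≈⟨ +-congʳ xy≈xz ⟩
      x * z - x * z  ≈⟨ -‿inverseʳ _ ⟩
      0#             ∎

  square≈0 : ∀ {x} → x * x ≈ 0# → x ≈ 0#
  square≈0 {x} x²≈0 with x ≟ 0#
  ... | yes x≈0 = x≈0
  ... | no  x≉0 = *-cancelˡ-0 x≉0 x²≈0

  x≤x+y : ∀ {x y} → 0# ≤ y → x ≤ x + y
  x≤x+y {x} {y} 0≤y =
    ≤-respˡ-≈ (+-identityˡ x) (≤-respʳ-≈ (+-comm y x) (+-monoˡ-≤ x 0≤y))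

  +-monoʳ-≤ : ∀ z {x y} → x ≤ y → z + x ≤ z + y
  +-monoʳ-≤ z x≤y = ≤-respˡ-≈ (+-comm _ z) (≤-respʳ-≈ (+-comm _ z) (+-monoˡ-≤ z x≤y))

  sumOfSquares≈0 : ∀ {x y} → x * x + y * y ≈ 0# → x ≈ 0# × y ≈ 0#
  sumOfSquares≈0 {x} {y} eq = left eq , left (trans (+-comm _ _) eq)
    where
    left : ∀ {x y} → x * x + y * y ≈ 0# → x ≈ 0#
    left {x} {y} eq = square≈0
      (antisym (≤-respʳ-≈ eq (x≤x+y (square-nonNegative y))) (square-nonNegative x))

  0≤1 : 0# ≤ 1#
  0≤1 = ≤-respʳ-≈ (*-identityʳ 1#) (square-nonNegative 1#)

  1+1≉0 : 1# + 1# ≉ 0#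
  1+1≉0 eq = fromℕ≉0 2 (trans (+-congˡ (+-identityʳ 1#)) eq)

  ≤-/ : ∀ {a b} n .{{_ : NonZero n}} → a ≤ fromℕ n * b → a / n ≤ b
  ≤-/ {a} {b} n a≤nb = ≤-respˡ-≈ (*-comm i a) (≤-respʳ-≈ cancel (*-monoˡ-≤ 0≤i a≤nb))
    where
    inverse = invertible (fromℕ n) (fromℕ≉0 n)
    i = proj₁ inverse
    0≤i : 0# ≤ i
    0≤i with total 0# i
    ... | inj₁ 0≤i = 0≤i
    -- If `i ≤ 0#`, then 1 = n i ≤ 0, which is impossible.
    ... | inj₂ i≤0 = ⊥-elim (0≉1 (antisym 0≤1 (≤-respˡ-≈ (proj₂ inverse)
      (≤-respʳ-≈ (zeroʳ _) (*-monoˡ-≤ (fromℕ-nonNegative n) i≤0)))))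
    cancel : i * (fromℕ n * b) ≈ b
    cancel = begin
      i * (fromℕ n * b)  ≈⟨ solve 3 (λ i n b → i :* (n :* b) := n :* i :* b) refl i (fromℕ n) b ⟩
      fromℕ n * i * b    ≈⟨ *-congʳ (proj₂ inverse) ⟩
      1# * b             ≈⟨ *-identityˡ b ⟩
      b                  ∎

  ≤-transpose : ∀ {x y z} → x ≤ y + z → x - z ≤ y
  ≤-transpose {x} {y} {z} x≤y+z = ≤-respʳ-≈
    (solve 2 (λ y z → y :+ z :- z := y) refl y z) (+-monoˡ-≤ (- z) x≤y+z)

-- Plane vectors, intersecting unit circles, and isometries

module EuclideanGeometry (R : RealNumbers) where
  open RealNumbers R hiding (zero)
  open RealArithmetic R
  open Plane R
  open OrderedField R
  open AbelianGroupProperties +-abelianGroup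
    using (x∙y⁻¹≈ε⇒x≈y; ε⁻¹≈ε; ∙-cancelˡ) renaming (⁻¹-injective to -‿injective)
  open IntegerCoefficients commutativeRing
  open SetoidReasoning ℝ-setoid

  infixl 6 _−_
  _−_ : Point → Point → Point
  (x₁ , y₁) − (x₂ , y₂) = x₁ - x₂ , y₁ - y₂

  infixl 7 _∙_ _∧_
  _∙_ : Point → Point → ℝ
  (x₁ , y₁) ∙ (x₂ , y₂) = x₁ * x₂ + y₁ * y₂

  -- The determinant of two vectors; in complex notation, the imaginary part of ū v.
  _∧_ : Point → Point → ℝ
  (x₁ , y₁) ∧ (x₂ , y₂) = x₁ * y₂ - y₁ * x₂

  O : Point
  O = 0# , 0#

  −≈O : ∀ {A B} → A − B ℂ.≈ O → A ℂ.≈ B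
  −≈O (x , y) = x∙y⁻¹≈ε⇒x≈y _ _ x , x∙y⁻¹≈ε⇒x≈y _ _ y

  ∙≉0 : ∀ {u} → ¬ u ℂ.≈ O → u ∙ u ≉ 0#
  ∙≉0 u≉O uu≈0 = u≉O (sumOfSquares≈0 uu≈0)

  dist² : ∀ A B → dist A B * dist A B ≈ (A − B) ∙ (A − B)
  dist² A B = √-square _ _

  -- Since `√` is abstract, distances are compared through their squares, which determine
  -- non-negative reals.
  dist-unique : ∀ A B A′ B′ → (A − B) ∙ (A − B) ≈ (A′ − B′) ∙ (A′ − B′) → dist A B ≈ dist A′ B′
  dist-unique A B A′ B′ eq = √-unique (√-nonNegative _ _) (√-nonNegative _ _)
    (trans (dist² A B) (trans eq (sym (dist² A′ B′))))

  dist-sym : ∀ A B → dist A B ≈ dist B A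
  dist-sym A@(a , b) B@(c , d) = dist-unique A B B A
    (solve 4 (λ a b c d → (a :- c) :* (a :- c) :+ (b :- d) :* (b :- d)
                       := (c :- a) :* (c :- a) :+ (d :- b) :* (d :- b)) refl a b c d)

  -- Follows from |w|² (u ∧ v) = (w ∧ v)(w ∙ u) - (w ∧ u)(w ∙ v), after cancelling |w|².
  orthogonal⇒parallel : ∀ w u v → ¬ w ℂ.≈ O → w ∙ u ≈ 0# → w ∙ v ≈ 0# → u ∧ v ≈ 0#
  orthogonal⇒parallel w@(w₁ , w₂) u@(u₁ , u₂) v@(v₁ , v₂) w≉O wu≈0 wv≈0 =
    *-cancelˡ-0 (∙≉0 w≉O) (begin
      w ∙ w * (u ∧ v)
        ≈⟨ solve 6 (λ w₁ w₂ u₁ u₂ v₁ v₂ →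
             (w₁ :* w₁ :+ w₂ :* w₂) :* (u₁ :* v₂ :- u₂ :* v₁)
             := (w₁ :* v₂ :- w₂ :* v₁) :* (w₁ :* u₁ :+ w₂ :* u₂)
                :+ (w₂ :* u₁ :- w₁ :* u₂) :* (w₁ :* v₁ :+ w₂ :* v₂))
             refl w₁ w₂ u₁ u₂ v₁ v₂ ⟩
      (w ∧ v) * (w ∙ u) + (w₂ * u₁ - w₁ * u₂) * (w ∙ v)
        ≈⟨ +-cong (*-congˡ wu≈0) (*-congˡ wv≈0) ⟩
      (w ∧ v) * 0# + (w₂ * u₁ - w₁ * u₂) * 0#
        ≈⟨ +-cong (zeroʳ _) (zeroʳ _) ⟩
      0# + 0#
        ≈⟨ +-identityˡ 0# ⟩
      0#  ∎)

  -- A line through a point of a circle meets the circle in at most one other point; u and v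
  -- are chords from a common endpoint, and m is twice the radius vector at that endpoint.
  parallelChords : ∀ m u v → ¬ u ℂ.≈ O → ¬ v ℂ.≈ O → u ∧ v ≈ 0# →
                   u ∙ m ≈ u ∙ u → v ∙ m ≈ v ∙ v → u ℂ.≈ v
  parallelChords m@(m₁ , m₂) u@(u₁ , u₂) v@(v₁ , v₂) u≉O v≉O uv≈0 um≈uu vm≈vv =
    -- Used in both orders, `projection` gives `u ∙ v ≈ v ∙ v` and `v ∙ u ≈ u ∙ u`, so |u - v|²
    -- vanishes.
    −≈O (sumOfSquares≈0 (begin
      (u − v) ∙ (u − v)
        ≈⟨ solve 4 (λ u₁ u₂ v₁ v₂ →
             (u₁ :- v₁) :* (u₁ :- v₁) :+ (u₂ :- v₂) :* (u₂ :- v₂)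
             := (u₁ :* u₁ :+ u₂ :* u₂) :- (v₁ :* u₁ :+ v₂ :* u₂)
                :+ ((v₁ :* v₁ :+ v₂ :* v₂) :- (u₁ :* v₁ :+ u₂ :* v₂)))
             refl u₁ u₂ v₁ v₂ ⟩
      u ∙ u - v ∙ u + (v ∙ v - u ∙ v)
        ≈⟨ +-cong (+-congˡ (-‿cong (projection v u v≉O vu≈0 vm≈vv um≈uu)))
                  (+-congˡ (-‿cong (projection u v u≉O uv≈0 um≈uu vm≈vv))) ⟩
      u ∙ u - u ∙ u + (v ∙ v - v ∙ v)
        ≈⟨ +-cong (-‿inverseʳ _) (-‿inverseʳ _) ⟩
      0# + 0#
        ≈⟨ +-identityˡ 0# ⟩
      0#  ∎))
    where
    -- The identity (u ∙ m)(u ∙ v) = (u ∙ u)(v ∙ m) + (m ∧ u)(u ∧ v) loses its last term for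
    -- parallel vectors; the two chord equations remove `m`, and `u ∙ u` cancels.
    projection : ∀ u v → ¬ u ℂ.≈ O → u ∧ v ≈ 0# → u ∙ m ≈ u ∙ u → v ∙ m ≈ v ∙ v → u ∙ v ≈ v ∙ v
    projection u@(u₁ , u₂) v@(v₁ , v₂) u≉O uv≈0 um≈uu vm≈vv = *-cancelˡ (∙≉0 u≉O) (begin
      (u ∙ u) * (u ∙ v)
        ≈⟨ *-congʳ um≈uu ⟨
      (u ∙ m) * (u ∙ v)
        ≈⟨ solve 6 (λ u₁ u₂ v₁ v₂ m₁ m₂ →
             (u₁ :* m₁ :+ u₂ :* m₂) :* (u₁ :* v₁ :+ u₂ :* v₂)
             := (u₁ :* u₁ :+ u₂ :* u₂) :* (v₁ :* m₁ :+ v₂ :* m₂)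
                :+ (m₁ :* u₂ :- m₂ :* u₁) :* (u₁ :* v₂ :- u₂ :* v₁))
             refl u₁ u₂ v₁ v₂ m₁ m₂ ⟩
      (u ∙ u) * (v ∙ m) + (m ∧ u) * (u ∧ v)
        ≈⟨ +-cong (*-congˡ vm≈vv) (trans (*-congˡ uv≈0) (zeroʳ _)) ⟩
      (u ∙ u) * (v ∙ v) + 0#
        ≈⟨ +-identityʳ _ ⟩
      (u ∙ u) * (v ∙ v)  ∎)
    vu≈0 : v ∧ u ≈ 0#
    vu≈0 = begin
      v ∧ u      ≈⟨ solve 4 (λ u₁ u₂ v₁ v₂ → v₁ :* u₂ :- v₂ :* u₁ := :- (u₁ :* v₂ :- u₂ :* v₁))
                      refl u₁ u₂ v₁ v₂ ⟩
      - (u ∧ v)  ≈⟨ -‿cong uv≈0 ⟩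
      - 0#       ≈⟨ ε⁻¹≈ε ⟩
      0#         ∎

  dist≈1⇒ : ∀ {A B} → dist A B ≈ 1# → (A − B) ∙ (A − B) ≈ 1#
  dist≈1⇒ {A} {B} eq = trans (sym (dist² A B)) (trans (*-cong eq eq) (*-identityˡ 1#))

  -- The line of centres is orthogonal to the common chord: twice the dot product is |BC|² - |AC|² +
  -- |AD|² - |BD|².
  equidistant⇒orthogonal : ∀ A B C D →
    dist A C ≈ 1# → dist B C ≈ 1# → dist A D ≈ 1# → dist B D ≈ 1# → (A − B) ∙ (C − D) ≈ 0#
  equidistant⇒orthogonal A@(a₁ , a₂) B@(b₁ , b₂) C@(c₁ , c₂) D@(d₁ , d₂) AC BC AD BD =
    *-cancelˡ-0 1+1≉0 (begin
      (1# + 1#) * ((A − B) ∙ (C − D))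
        ≈⟨ solve 8 (λ a₁ a₂ b₁ b₂ c₁ c₂ d₁ d₂ →
             (con (+ 1) :+ con (+ 1)) :* ((a₁ :- b₁) :* (c₁ :- d₁) :+ (a₂ :- b₂) :* (c₂ :- d₂))
             := (b₁ :- c₁) :* (b₁ :- c₁) :+ (b₂ :- c₂) :* (b₂ :- c₂)
                :- ((a₁ :- c₁) :* (a₁ :- c₁) :+ (a₂ :- c₂) :* (a₂ :- c₂))
                :+ ((a₁ :- d₁) :* (a₁ :- d₁) :+ (a₂ :- d₂) :* (a₂ :- d₂)
                    :- ((b₁ :- d₁) :* (b₁ :- d₁) :+ (b₂ :- d₂) :* (b₂ :- d₂))))
             refl a₁ a₂ b₁ b₂ c₁ c₂ d₁ d₂ ⟩
      (B − C) ∙ (B − C) - (A − C) ∙ (A − C) + ((A − D) ∙ (A − D) - (B − D) ∙ (B − D))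
        ≈⟨ +-cong (+-cong (dist≈1⇒ BC) (-‿cong (dist≈1⇒ AC)))
                  (+-cong (dist≈1⇒ AD) (-‿cong (dist≈1⇒ BD))) ⟩
      1# - 1# + (1# - 1#)
        ≈⟨ solve 0 (con (+ 1) :- con (+ 1) :+ (con (+ 1) :- con (+ 1)) := con (+ 0)) refl ⟩
      0#  ∎)

  -- Provides the hypothesis on `m` in `parallelChords`, with `m` equal to 2(C - A). The two sides
  -- differ by |AC|² - |AD|².
  chord : ∀ A C D → dist A C ≈ 1# → dist A D ≈ 1# →
          (C − D) ∙ ((C − A) − (A − C)) ≈ (C − D) ∙ (C − D)
  chord A@(a₁ , a₂) C@(c₁ , c₂) D@(d₁ , d₂) AC AD = begin
    (C − D) ∙ ((C − A) − (A − C))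
      ≈⟨ solve 6 (λ a₁ a₂ c₁ c₂ d₁ d₂ →
           (c₁ :- d₁) :* (c₁ :- a₁ :- (a₁ :- c₁)) :+ (c₂ :- d₂) :* (c₂ :- a₂ :- (a₂ :- c₂))
           := (c₁ :- d₁) :* (c₁ :- d₁) :+ (c₂ :- d₂) :* (c₂ :- d₂)
              :+ ((a₁ :- c₁) :* (a₁ :- c₁) :+ (a₂ :- c₂) :* (a₂ :- c₂)
                  :- ((a₁ :- d₁) :* (a₁ :- d₁) :+ (a₂ :- d₂) :* (a₂ :- d₂))))
           refl a₁ a₂ c₁ c₂ d₁ d₂ ⟩
    (C − D) ∙ (C − D) + ((A − C) ∙ (A − C) - (A − D) ∙ (A − D))
      ≈⟨ +-congˡ (+-cong (dist≈1⇒ AC) (-‿cong (dist≈1⇒ AD))) ⟩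
    (C − D) ∙ (C − D) + (1# - 1#)
      ≈⟨ trans (+-congˡ (-‿inverseʳ 1#)) (+-identityʳ _) ⟩
    (C − D) ∙ (C − D)  ∎

  -- The chords from `C` to `D` and to `E` are both orthogonal to the line of centres, hence
  -- parallel, and parallel chords from one endpoint coincide.
  unitCircles-meet : ∀ A B C D E → ¬ A ℂ.≈ B → ¬ C ℂ.≈ D → ¬ C ℂ.≈ E →
    dist A C ≈ 1# → dist A D ≈ 1# → dist A E ≈ 1# →
    dist B C ≈ 1# → dist B D ≈ 1# → dist B E ≈ 1# → D ℂ.≈ E
  unitCircles-meet A B C@(c₁ , c₂) D@(d₁ , d₂) E@(e₁ , e₂) A≉B C≉D C≉E AC AD AE BC BD BE =
    cancel (proj₁ CD≈CE) , cancel (proj₂ CD≈CE)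
    where
    CD≈CE : C − D ℂ.≈ C − E
    CD≈CE = parallelChords ((C − A) − (A − C)) (C − D) (C − E) (C≉D ∘ −≈O) (C≉E ∘ −≈O)
      (orthogonal⇒parallel (A − B) (C − D) (C − E) (A≉B ∘ −≈O)
        (equidistant⇒orthogonal A B C D AC BC AD BD)
        (equidistant⇒orthogonal A B C E AC BC AE BE))
      (chord A C D AC AD) (chord A C E AC AE)
    cancel : ∀ {x y z} → x - y ≈ x - z → y ≈ z
    cancel eq = -‿injective (∙-cancelˡ _ _ _ eq)

  -- A polar form that includes the zero vector, so that `normalForm` also covers coinciding points.
  normalise : ∀ u {r} → r * r ≈ u ∙ u →
    ∃[ v ] v ∙ v ≈ 1# × u ℂ.≈ (r * proj₁ v , r * proj₂ v)
  normalise u@(x , y) {r} r²≈uu with r ≟ 0#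
  -- Here `u` is zero and every unit vector would serve.
  ... | yes r≈0 = (1# , 0#)
                , solve 0 (con (+ 1) :* con (+ 1) :+ con (+ 0) :* con (+ 0) := con (+ 1)) refl
                , trans x≈0 (sym (trans (*-identityʳ r) r≈0)) , trans y≈0 (sym (zeroʳ r))
    where
    u≈O : u ℂ.≈ O
    u≈O = sumOfSquares≈0 (trans (sym r²≈uu) (trans (*-congˡ r≈0) (zeroʳ r)))
    x≈0 = proj₁ u≈O
    y≈0 = proj₂ u≈O
  ... | no r≉0 with invertible r r≉0
  ...   | i , ri≈1 = (i * x , i * y) , (begin
      i * x * (i * x) + i * y * (i * y)
        ≈⟨ solve 3 (λ i x y → i :* x :* (i :* x) :+ i :* y :* (i :* y)
                   := i :* i :* (x :* x :+ y :* y)) refl i x y ⟩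
      i * i * (u ∙ u)
        ≈⟨ *-congˡ r²≈uu ⟨
      i * i * (r * r)
        ≈⟨ solve 2 (λ i r → i :* i :* (r :* r) := r :* i :* (r :* i)) refl i r ⟩
      r * i * (r * i)
        ≈⟨ *-cong ri≈1 ri≈1 ⟩
      1# * 1#
        ≈⟨ *-identityˡ 1# ⟩
      1#  ∎) , cancel x , cancel y
    where
    cancel : ∀ z → z ≈ r * (i * z)
    cancel z = begin
      z            ≈⟨ *-identityˡ z ⟨
      1# * z       ≈⟨ *-congʳ ri≈1 ⟨
      r * i * z    ≈⟨ *-assoc r i z ⟩
      r * (i * z)  ∎

  -- Z ↦ v̄ (Z - A) in complex notation.
  moveToOrigin : ∀ (A v : Point) → v ∙ v ≈ 1# → Isometry
  moveToOrigin A@(a , b) v@(p , q) vv≈1 = record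
    { bijection = record
      { to        = to
      ; from      = from
      ; to-cong   = to-cong
      ; from-cong = from-cong
      ; inverse   = (λ {X} Y≈ → ℂ.trans (to-cong Y≈) (to-from X))
                  , (λ {X} Y≈ → ℂ.trans (from-cong Y≈) (from-to X))
      }
    ; isometric = isometric
    }
    where
    to from : Point → Point
    to   (x , y) = p * (x - a) + q * (y - b) , p * (y - b) - q * (x - a)
    from (x , y) = p * x - q * y + a , p * y + q * x + b
    to-cong : ∀ {X Y} → X ℂ.≈ Y → to X ℂ.≈ to Y
    to-cong (x , y) =
        +-cong (*-congˡ (+-congʳ x)) (*-congˡ (+-congʳ y))
      , +-cong (*-congˡ (+-congʳ y)) (-‿cong (*-congˡ (+-congʳ x)))
    from-cong : ∀ {X Y} → X ℂ.≈ Y → from X ℂ.≈ from Y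
    from-cong (x , y) =
        +-congʳ (+-cong (*-congˡ x) (-‿cong (*-congˡ y)))
      , +-congʳ (+-cong (*-congˡ y) (*-congˡ x))
    scale : ∀ z → v ∙ v * z ≈ z
    scale z = trans (*-congʳ vv≈1) (*-identityˡ z)
    to-from : ∀ X → to (from X) ℂ.≈ X
    to-from (x , y) =
        trans (solve 6 (λ p q a b x y →
          p :* (p :* x :- q :* y :+ a :- a) :+ q :* (p :* y :+ q :* x :+ b :- b)
          := (p :* p :+ q :* q) :* x) refl p q a b x y) (scale x)
      , trans (solve 6 (λ p q a b x y →
          p :* (p :* y :+ q :* x :+ b :- b) :- q :* (p :* x :- q :* y :+ a :- a)
          := (p :* p :+ q :* q) :* y) refl p q a b x y) (scale y)
    from-to : ∀ X → from (to X) ℂ.≈ X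
    from-to (x , y) =
        trans (solve 6 (λ p q a b x y →
          p :* (p :* (x :- a) :+ q :* (y :- b)) :- q :* (p :* (y :- b) :- q :* (x :- a)) :+ a
          := (p :* p :+ q :* q) :* (x :- a) :+ a) refl p q a b x y)
          (trans (+-congʳ (scale (x - a))) (solve 2 (λ x a → x :- a :+ a := x) refl x a))
      , trans (solve 6 (λ p q a b x y →
          p :* (p :* (y :- b) :- q :* (x :- a)) :+ q :* (p :* (x :- a) :+ q :* (y :- b)) :+ b
          := (p :* p :+ q :* q) :* (y :- b) :+ b) refl p q a b x y)
          (trans (+-congʳ (scale (y - b))) (solve 2 (λ x a → x :- a :+ a := x) refl y b))
    isometric : ∀ X Y → dist (to X) (to Y) ≈ dist X Y
    isometric X@(x , y) Y@(x′ , y′) = dist-unique (to X) (to Y) X Y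
      (trans (solve 8 (λ p q a b x y x′ y′ →
        let e = (p :* (x :- a) :+ q :* (y :- b)) :- (p :* (x′ :- a) :+ q :* (y′ :- b))
            f = (p :* (y :- b) :- q :* (x :- a)) :- (p :* (y′ :- b) :- q :* (x′ :- a))
        in e :* e :+ f :* f
           := (p :* p :+ q :* q) :* ((x :- x′) :* (x :- x′) :+ (y :- y′) :* (y :- y′)))
        refl p q a b x y x′ y′)
        (scale _))

  -- Translate `A` to the origin, then rotate the direction of B - A onto the positive real axis;
  -- the image is the reference pair in the definition of `p`.
  normalForm : ∀ A B → ∃[ T ] (Isometry.to T A ℂ.≈ O) × (Isometry.to T B ℂ.≈ (dist A B , 0#))
  normalForm A@(a , b) B@(c , d)
    with normalise (B − A) (trans (*-cong (dist-sym A B) (dist-sym A B)) (dist² B A))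
  ... | v@(p , q) , vv≈1 , x , y = moveToOrigin A v vv≈1
    , ( solve 4 (λ p q a b → p :* (a :- a) :+ q :* (b :- b) := con (+ 0)) refl p q a b
      , solve 4 (λ p q a b → p :* (b :- b) :- q :* (a :- a) := con (+ 0)) refl p q a b)
    , ( (begin
          p * (c - a) + q * (d - b)    ≈⟨ +-cong (*-congˡ x) (*-congˡ y) ⟩
          p * (r * p) + q * (r * q)    ≈⟨ solve 3 (λ p q r → p :* (r :* p) :+ q :* (r :* q)
                                            := (p :* p :+ q :* q) :* r) refl p q r ⟩
          v ∙ v * r                    ≈⟨ *-congʳ vv≈1 ⟩
          1# * r                       ≈⟨ *-identityˡ r ⟩
          r                            ∎)
      , (begin
          p * (d - b) - q * (c - a)    ≈⟨ +-cong (*-congˡ y) (-‿cong (*-congˡ x)) ⟩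
          p * (r * q) - q * (r * p)    ≈⟨ solve 3 (λ p q r → p :* (r :* q) :- q :* (r :* p)
                                            := con (+ 0)) refl p q r ⟩
          0#                           ∎))
    where r = dist A B

-- The union bound for finitely additive measures

module Measure {R : RealNumbers} {G : Group 0ℓ 0ℓ} (μ : LeftInvariantProbability R G) where
  open RealNumbers R hiding (zero)
  open OrderedField R
  open RingProperties ring using (x+x≈x⇒x≈0)
  open LeftInvariantProbability μ
  open Group G using (setoid)

  measure-ext : ∀ E F → (∀ g → member E g → member F g) → (∀ g → member F g → member E g) →
                measure E ≈ measure F
  measure-ext E F E⊆F F⊆E = cong {E} {F} ((λ {g} → E⊆F g) , (λ {g} → F⊆E g))

  -- An empty set is disjoint from itself and equal to its union with itself, so additivity gives x
  -- = x + x for its measure x.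
  measure-empty : ∀ {E} → (∀ g → ¬ member E g) → measure E ≈ 0#
  measure-empty {E} E≡∅ = x+x≈x⇒x≈0 _
    (sym (trans (cong {E} {E ∪ E} (inj₁ , Sum.reduce))
                (additive {E} {E} λ g (g∈E , _) → E≡∅ g g∈E)))

  infixl 7 _∖_
  _∖_ : Subset setoid → Subset setoid → Subset setoid
  F ∖ E = record
    { member   = λ g → member F g × ¬ member E g
    ; respects = λ g≈h (g∈F , g∉E) → respects F g≈h g∈F , g∉E ∘ respects E (Group.sym G g≈h)
    }

  infixr 7 _∩_
  _∩_ : Subset setoid → Subset setoid → Subset setoid
  F ∩ E = record
    { member   = λ g → member F g × member E g
    ; respects = λ g≈h (g∈F , g∈E) → respects F g≈h g∈F , respects E g≈h g∈E
    }

  -- The decision `E?` splits `F` into its parts outside and inside `E`, and the latter has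
  -- non-negative measure.
  measure-∖ : ∀ {E F} → Decidable (member E) → measure (F ∖ E) ≤ measure F
  measure-∖ {E} {F} E? = ≤-respʳ-≈
    (sym (trans (cong {F} {F ∖ E ∪ F ∩ E} (split , Sum.[ proj₁ , proj₁ ]))
                (additive {F ∖ E} {F ∩ E} λ g ((_ , g∉E) , (_ , g∈E)) → g∉E g∈E)))
    (x≤x+y (nonNegative (F ∩ E)))
    where
    split : ∀ {g} → member F g → member (F ∖ E ∪ F ∩ E) g
    split {g} g∈F with E? g
    ... | yes g∈E = inj₂ (g∈F , g∈E)
    ... | no  g∉E = inj₁ (g∈F , g∉E)

  measure-∪ : ∀ {E F} → Decidable (member E) → measure (E ∪ F) ≤ measure E + measure F
  measure-∪ {E} {F} E? = ≤-respˡ-≈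
    (sym (trans (cong {E ∪ F} {E ∪ F ∖ E} (split , Sum.map₂ proj₁))
                (additive {E} {F ∖ E} λ g (g∈E , (_ , g∉E)) → g∉E g∈E)))
    (+-monoʳ-≤ (measure E) (measure-∖ {E} {F} E?))
    where
    split : ∀ {g} → member (E ∪ F) g → member (E ∪ F ∖ E) g
    split {g} (inj₁ g∈E) = inj₁ g∈E
    split {g} (inj₂ g∈F) with E? g
    ... | yes g∈E = inj₁ g∈E
    ... | no  g∉E = inj₂ (g∈F , g∉E)

  module _ {I : Set} (E : I → Subset setoid) where

    ⋃ : List I → Subset setoid
    ⋃ is = record
      { member   = λ g → Any (λ i → member (E i) g) is
      ; respects = λ g≈h → Any.map λ {i} → respects (E i) g≈h
      }

    unionBound : (∀ i → Decidable (member (E i))) →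
                 ∀ is → measure (⋃ is) ≤ foldr _+_ 0# (map (measure ∘ E) is)
    unionBound E? []       = ≤-reflexive (measure-empty {⋃ []} λ _ ())
    unionBound E? (i ∷ is) = ≤-respˡ-≈
      (cong {E i ∪ ⋃ is} {⋃ (i ∷ is)} (Any.fromSum , Any.toSum))
      (≤-trans (measure-∪ {E i} {⋃ is} (E? i))
               (+-monoʳ-≤ (measure (E i)) (unionBound E? is)))

    covering⇒1≤ : (∀ i → Decidable (member (E i))) →
                  ∀ is → (∀ g → member (⋃ is) g) → 1# ≤ foldr _+_ 0# (map (measure ∘ E) is)
    covering⇒1≤ E? is cover = ≤-respˡ-≈
      (trans (cong {⋃ is} {full} ((λ _ → tt) , (λ {g} _ → cover g))) normalised)
      (unionBound E? is)

-- Invariance of the monochromaticity probabilities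

module RandomColouring (R : RealNumbers) (c₀ : Colouring.ProperColouring R 4)
                       (μ : LeftInvariantProbability R (Colouring.S₄×E2 R)) where
  open RealNumbers R hiding (zero)
  open Plane R
  open Colouring R
  open Monochromaticity c₀ μ
  open ProperColouring c₀
  open LeftInvariantProbability μ
  open EuclideanGeometry R using (O; normalForm)
  open Measure μ using (measure-ext; measure-empty)
  private module G = Group S₄×E2

  randomColour-cong : ∀ g {A B} → A ℂ.≈ B → randomColour g A ≡ randomColour g B
  randomColour-cong (σ , T) A≈B = ≡.cong (Inverse.to σ) (colour-cong (Isometry.from-cong T A≈B))

  measure-sameColour-cong : ∀ {A A′ B B′} → A ℂ.≈ A′ → B ℂ.≈ B′ →
                            measure (sameColour A B) ≈ measure (sameColour A′ B′)
  measure-sameColour-cong {A} {A′} {B} {B′} A≈A′ B≈B′ =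
    measure-ext (sameColour A B) (sameColour A′ B′)
      (implies A≈A′ B≈B′) (implies (ℂ.sym A≈A′) (ℂ.sym B≈B′))
    where
    implies : ∀ {A A′ B B′} → A ℂ.≈ A′ → B ℂ.≈ B′ →
              ∀ g → member (sameColour A B) g → member (sameColour A′ B′) g
    implies A≈A′ B≈B′ g eq = ≡.trans (≡.sym (randomColour-cong g A≈A′))
                                     (≡.trans eq (randomColour-cong g B≈B′))

  p-cong : ∀ {x y} → x ≈ y → p x ≈ p y
  p-cong {x} {y} x≈y = measure-sameColour-cong {O} {O} {x , 0#} {y , 0#} ℂ.refl (x≈y , refl)

  -- Left translation by (id, T) carries one event to the other, because the inverse of T ∘ U sends
  -- T A to the same point as the inverse of U sends A.
  measure-isometric : ∀ T A B →
    measure (sameColour A B) ≈ measure (sameColour (Isometry.to T A) (Isometry.to T B))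
  measure-isometric T A B = trans (sym (leftInvariant t (sameColour A B)))
    (measure-ext (leftTranslate S₄×E2 t (sameColour A B)) (sameColour (T.to A) (T.to B))
      forward backward)
    where
    module T = Isometry T
    t : G.Carrier
    t = proj₁ G.ε , T
    forward : ∀ g → member (leftTranslate S₄×E2 t (sameColour A B)) g →
              member (sameColour (T.to A) (T.to B)) g
    forward g (h , h∈ , g≈th) =
      respects (sameColour (T.to A) (T.to B)) {t G.∙ h} {g}
        ((λ i → ≡.sym (proj₁ g≈th i)) , (λ X → ℂ.sym (proj₂ g≈th X)))
        (≡.trans (randomColour-cong h (T.strictlyInverseʳ A))
          (≡.trans h∈ (≡.sym (randomColour-cong h (T.strictlyInverseʳ B)))))
    backward : ∀ g → member (sameColour (T.to A) (T.to B)) g →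
               member (leftTranslate S₄×E2 t (sameColour A B)) g
    -- The colour of `A` under `t G.⁻¹ G.∙ g` computes to the colour of `T.to A` under `g`, so `g∈`
    -- itself proves membership.
    backward g g∈ = t G.⁻¹ G.∙ g , g∈
      , (λ i → ≡.refl) , (λ X → ℂ.sym (T.strictlyInverseˡ (Isometry.to (proj₂ g) X)))

  measure-sameColour : ∀ A B → measure (sameColour A B) ≈ p (dist A B)
  measure-sameColour A B =
    let T , TA≈O , TB≈d = normalForm A B in
    trans (measure-isometric T A B)
      (measure-sameColour-cong {Isometry.to T A} {O} {Isometry.to T B} {dist A B , 0#} TA≈O TB≈d)

  -- The event is empty: T⁻¹ preserves the unit distance, `c₀` separates the two preimages, and `σ`
  -- is injective.
  measure-unit : ∀ A B → dist A B ≈ 1# → measure (sameColour A B) ≈ 0#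
  measure-unit A B AB≈1 = measure-empty {sameColour A B} λ (σ , T) eq →
    proper {Isometry.from T A} {Isometry.from T B}
      (trans (Isometry.isometric (Group._⁻¹ E2 T) A B) AB≈1)
      (Injection.injective (Inverse⇒Injection σ) eq)

-- Copies of K₂,₃ on five vertices avoiding two given pairs

infix 4 _≁_
-- Distinctness as unordered pairs.
_≁_ : ∀ {n} → Rel (Fin n × Fin n) 0ℓ
x ≁ y = x ≢ y × swap x ≢ y

_≁?_ : ∀ {n} (x y : Fin n × Fin n) → Dec (x ≁ y)
x ≁? y = ¬? (≡-dec Fin._≟_ Fin._≟_ x y) ×-dec ¬? (≡-dec Fin._≟_ Fin._≟_ (swap x) y)

-- The parts are {a, b} and {c, d, e}. That the five vertices differ is recorded separately, in
-- `bipartitions-unique`.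
record Bipartition : Set where
  constructor bipartition
  field
    a b c d e : Fin 5

  vertices : List (Fin 5)
  vertices = a ∷ b ∷ c ∷ d ∷ e ∷ []

  edges : List (Fin 5 × Fin 5)
  edges = cartesianProduct (a ∷ b ∷ []) (c ∷ d ∷ e ∷ [])

open Bipartition using (vertices; edges)

-- One entry for each of the ten choices of the two-element part.
bipartitions : List Bipartition
bipartitions
  = bipartition (# 0) (# 1) (# 2) (# 3) (# 4)
  ∷ bipartition (# 0) (# 2) (# 1) (# 3) (# 4)
  ∷ bipartition (# 0) (# 3) (# 1) (# 2) (# 4)
  ∷ bipartition (# 0) (# 4) (# 1) (# 2) (# 3)
  ∷ bipartition (# 1) (# 2) (# 0) (# 3) (# 4)
  ∷ bipartition (# 1) (# 3) (# 0) (# 2) (# 4)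
  ∷ bipartition (# 1) (# 4) (# 0) (# 2) (# 3)
  ∷ bipartition (# 2) (# 3) (# 0) (# 1) (# 4)
  ∷ bipartition (# 2) (# 4) (# 0) (# 1) (# 3)
  ∷ bipartition (# 3) (# 4) (# 0) (# 1) (# 2)
  ∷ []

bipartitions-unique : All (Unique ∘ vertices) bipartitions
bipartitions-unique = toWitness {a? = all? (unique? ∘ vertices) bipartitions} tt

Avoids : Fin 5 × Fin 5 → Pred Bipartition 0ℓ
Avoids x s = All (_≁ x) (edges s)

avoids? : ∀ x → Decidable (Avoids x)
avoids? x s = all? (_≁? x) (edges s)

avoidTwo? : ∀ x y → Dec (Any (λ s → Avoids x s × Avoids y s) bipartitions)
avoidTwo? x y = any? (λ s → avoids? x s ×-dec avoids? y s) bipartitions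

-- Definitionally `Configuration.pairs` for five points, but free of the points themselves, so that
-- the check below is a closed computation.
orderedPairs : List (Fin 5 × Fin 5)
orderedPairs = filter (λ (i , j) → i Fin.<? j) (cartesianProduct (allFin 5) (allFin 5))

abstract
  -- Checked by evaluation. A pair avoids the edges when both its ends lie in one part: two pairs
  -- sharing a vertex fit into a common three-element part, and of two disjoint pairs one can be the
  -- two-element part.
  avoidAnyTwo : All (λ x → All (λ y → Any (λ s → Avoids x s × Avoids y s) bipartitions)
                               orderedPairs) orderedPairs
  avoidAnyTwo = toWitness {a? = all? (λ x → all? (avoidTwo? x) orderedPairs) orderedPairs} tt

avoidTwo : ∀ {x y} → x ∈ orderedPairs → y ∈ orderedPairs →
           ∃[ s ] Unique (vertices s) × Avoids x s × Avoids y s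
avoidTwo x∈ y∈ =
  let s , s∈ , ax , ay = find (lookup (lookup avoidAnyTwo x∈) y∈)
  in s , lookup bipartitions-unique s∈ , ax , ay

avoidAll : ∀ xs → (∀ {x} → x ∈ xs → x ∈ orderedPairs) → length xs ℕ.≤ 2 →
           ∃[ s ] Unique (vertices s) × All (λ x → Avoids x s) xs
-- Shorter lists are padded to two pairs: the pair (0, 1) is a dummy here, and a single pair is
-- repeated in the next clause.
avoidAll []               _  _ with avoidTwo {# 0 , # 1} (here ≡.refl) (here ≡.refl)
... | s , u , _ = s , u , []
avoidAll (x ∷ [])         x∈ _ with avoidTwo (x∈ (here ≡.refl)) (x∈ (here ≡.refl))
... | s , u , ax , _ = s , u , ax ∷ []
avoidAll (x ∷ y ∷ [])     x∈ _ with avoidTwo (x∈ (here ≡.refl)) (x∈ (there (here ≡.refl)))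
... | s , u , ax , ay = s , u , ax ∷ ay ∷ []
avoidAll (_ ∷ _ ∷ _ ∷ _) _ (s≤s (s≤s ()))

-- Counting pairs by filtering

module _ {A : Set} {P : Pred A 0ℓ} (P? : Decidable P) where

  length-filter-¬ : ∀ xs → length (filter P? xs) ℕ.+ length (filter (¬? ∘ P?) xs) ≡ length xs
  length-filter-¬ []       = ≡.refl
  length-filter-¬ (x ∷ xs) with P? x
  ... | yes _ = ≡.cong suc (length-filter-¬ xs)
  ... | no  _ = ≡.trans (ℕ.+-suc _ _) (≡.cong suc (length-filter-¬ xs))

  length-filter≡0 : ∀ {x xs} → length (filter P? xs) ≡ 0 → x ∈ xs → ¬ P x
  length-filter≡0 {xs = xs} eq x∈xs Px with filter P? xs | ∈-filter⁺ P? x∈xs Px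
  length-filter≡0 () x∈xs Px | _ ∷ _ | _

module Counting (R : RealNumbers) (d : RealNumbers.ℝ R) {m : ℕ} (P : Fin m → Plane.Point R) where
  open RealNumbers R
  open Plane R
  open Configuration R d P

  ∈-pairs : ∀ {i j} → i Fin.< j → (i , j) ∈ pairs
  ∈-pairs {i} {j} i<j = ∈-filter⁺ (λ (i , j) → i Fin.<? j)
    (∈-cartesianProduct⁺ (∈-allFin i) (∈-allFin j)) i<j

  otherPairs : List Pair
  otherPairs = filter (¬? ∘ hasDistance-1-or-d?) pairs

-- Existence of a pair at distance d

module FivePoints (R : RealNumbers) (d : RealNumbers.ℝ R) (P : Fin 5 → Plane.Point R) where
  open RealNumbers R
  open Plane R
  open Configuration R d P
  open Counting R d P
  open EuclideanGeometry R using (dist-sym; unitCircles-meet)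

  otherPairs≤2 : 8 ℕ.≤ pairsAt-1-or-d → length otherPairs ℕ.≤ 2
  -- The length of `pairs` evaluates to 10, which is read as 8 + 2.
  otherPairs≤2 8≤k = ℕ.+-cancelˡ-≤ 8 _ _ (ℕ.≤-trans (ℕ.+-monoˡ-≤ (length otherPairs) 8≤k)
    (ℕ.≤-reflexive (length-filter-¬ hasDistance-1-or-d? pairs)))

  orderedUnitPair : pairsAt-d ≡ 0 → ∀ {i j} → i Fin.< j → ¬ (i , j) ∈ otherPairs →
                    dist (P i) (P j) ≈ 1#
  orderedUnitPair n≡0 {i} {j} i<j ij∉ with hasDistance-1-or-d? (i , j)
  ... | yes (inj₁ at1) = at1
  ... | yes (inj₂ atd) = contradiction atd (length-filter≡0 hasDistance-d? n≡0 (∈-pairs i<j))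
  ... | no  other      =
    contradiction (∈-filter⁺ (¬? ∘ hasDistance-1-or-d?) (∈-pairs i<j) other) ij∉

  unitPair : pairsAt-d ≡ 0 → ∀ {i j} → i ≢ j → All ((i , j) ≁_) otherPairs →
             dist (P i) (P j) ≈ 1#
  unitPair n≡0 {i} {j} i≢j avoids with Fin.<-cmp i j
  ... | tri< i<j _ _ = orderedUnitPair n≡0 i<j λ ij∈ → proj₁ (lookup avoids ij∈) ≡.refl
  ... | tri≈ _ i≡j _ = contradiction i≡j i≢j
  -- Only pairs with the smaller index first are listed, so the edge is reversed; the swapped half
  -- of `≁` excludes it from `otherPairs`.
  ... | tri> _ _ j<i = trans (dist-sym (P i) (P j))
    (orderedUnitPair n≡0 j<i λ ji∈ → proj₂ (lookup avoids ji∈) ≡.refl)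

  -- This makes the division by n meaningful. If n were 0, all six edges of a K₂,₃ avoiding
  -- `otherPairs` would be unit pairs, and the unit circles about `a` and `b` would share three
  -- points.
  pairsAt-d≢0 : Distinct → 8 ℕ.≤ pairsAt-1-or-d → pairsAt-d ≢ 0
  pairsAt-d≢0 P-distinct 8≤k n≡0
    with avoidAll otherPairs (proj₁ ∘ ∈-filter⁻ (¬? ∘ hasDistance-1-or-d?)) (otherPairs≤2 8≤k)
  ... | s , (a≢b ∷ a≢c ∷ a≢d ∷ a≢e ∷ []) ∷ (b≢c ∷ b≢d ∷ b≢e ∷ [])
            ∷ (c≢d ∷ c≢e ∷ []) ∷ (d≢e ∷ []) ∷ [] ∷ [] , avoids
    = d≢e (P-distinct (unitCircles-meet (P a) (P b) (P c) (P d′) (P e)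
        (a≢b ∘ P-distinct) (c≢d ∘ P-distinct) (c≢e ∘ P-distinct)
        (unit a≢c (here ≡.refl)) (unit a≢d (there (here ≡.refl))) (unit a≢e (there (there (here ≡.refl))))
        (unit b≢c (there (there (there (here ≡.refl)))))
        (unit b≢d (there (there (there (there (here ≡.refl))))))
        (unit b≢e (there (there (there (there (there (here ≡.refl)))))))))
    where
    open Bipartition s using (a; b; c; e) renaming (d to d′)
    unit : ∀ {i j} → i ≢ j → (i , j) ∈ edges s → dist (P i) (P j) ≈ 1#
    unit i≢j ij∈ = unitPair n≡0 i≢j (All.map (λ avoid → lookup avoid ij∈) avoids)

-- Splitting a sum by distance

module Sums (R : RealNumbers) where
  open RealNumbers R hiding (zero)
  open RealArithmetic R
  open IntegerCoefficients commutativeRing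

  sum : List ℝ → ℝ
  sum = foldr _+_ 0#

  module _ {I : Set} {D U : Pred I 0ℓ} (D? : Decidable D) (U? : Decidable U)
           {q r : I → ℝ} {x : ℝ}
           (q≈x : ∀ i → D i → q i ≈ x) (q≈0 : ∀ i → U i → q i ≈ 0#) (q≈r : ∀ i → q i ≈ r i) where

    -- In the application `D` is distance d, `U` is unit distance, `q` is the measure of the event
    -- and `r` its value through `p`. The last filter has the form used in `otherDistances`.
    sum-split : ∀ is → sum (map q is) ≈ fromℕ (length (filter D? is)) * x
                         + sum (map r (filter (λ i → ¬? (U? i ⊎-dec D? i)) is))
    sum-split []       = sym (trans (+-identityʳ _) (zeroˡ x))
    sum-split (i ∷ is) with U? i | D? i
    ... | yes u | no _  = trans (+-cong (q≈0 i u) (sum-split is)) (+-identityˡ _)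
    ... | no _  | no _  = trans (+-cong (q≈r i) (sum-split is))
      (solve 3 (λ a b c → a :+ (b :+ c) := b :+ (a :+ c)) refl _ _ _)
    -- Both predicates hold when d = 1; the filter for `D` counts the entry, so it is valued at `x`.
    ... | yes _ | yes δ = trans (+-cong (q≈x i δ) (sum-split is))
      (solve 3 (λ n x c → x :+ (n :* x :+ c) := (con (+ 1) :+ n) :* x :+ c) refl _ x _)
    ... | no _  | yes δ = trans (+-cong (q≈x i δ) (sum-split is))
      (solve 3 (λ n x c → x :+ (n :* x :+ c) := (con (+ 1) :+ n) :* x :+ c) refl _ x _)

-- The three lower bounds

module Inequalities (R : RealNumbers) (c₀ : Colouring.ProperColouring R 4)
                    (μ : LeftInvariantProbability R (Colouring.S₄×E2 R))
                    (d : RealNumbers.ℝ R) (P : Fin 5 → Plane.Point R) where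
  open RealNumbers R hiding (zero)
  open RealArithmetic R
  open Colouring R
  open Monochromaticity c₀ μ
  open LeftInvariantProbability μ using (measure)
  open Configuration R d P
  open Counting R d P
  open OrderedField R
  open Sums R
  open Measure μ using (covering⇒1≤)
  open RandomColouring R c₀ μ
  open Permutation ℝ-setoid using (_↭_)
  open IntegerCoefficients commutativeRing

  monochromatic : Pair → Subset (Group.setoid S₄×E2)
  monochromatic e = sameColour (P (proj₁ e)) (P (proj₂ e))

  1≤sum : 1# ≤ sum (map (measure ∘ monochromatic) pairs)
  1≤sum = covering⇒1≤ monochromatic (λ e g → _ Fin.≟ _) pairs λ g →
    let i , j , i<j , gᵢ≡gⱼ = Fin.pigeonhole (ℕ.n<1+n 4) (λ i → randomColour g (P i))
    in lose (∈-pairs i<j) gᵢ≡gⱼ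

  -- The common source of all three bounds: in the union bound the pairs at distance d are
  -- collected, and the remaining unit pairs drop out.
  1≤ : 1# ≤ fromℕ pairsAt-d * p d + sum (map p otherDistances)
  1≤ = ≤-respʳ-≈
    (trans
      (sum-split hasDistance-d? (λ e → pairDist e ≟ 1#) {r = p ∘ pairDist}
        (λ e at-d → trans (measure-sameColour (P (proj₁ e)) (P (proj₂ e))) (p-cong at-d))
        (λ e → measure-unit (P (proj₁ e)) (P (proj₂ e)))
        (λ e → measure-sameColour (P (proj₁ e)) (P (proj₂ e)))
        pairs)
      (+-congˡ (reflexive (≡.cong sum (map-∘ otherPairs)))))
    1≤sum

  -- The other distances are prescribed only up to order and equality of reals; addition is
  -- commutative and `p` respects that equality.
  sum-↭ : ∀ {xs} → otherDistances ↭ xs → sum (map p otherDistances) ≈ sum (map p xs)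
  sum-↭ perm = PermutationProperties.foldr-commMonoid ℝ-setoid +-isCommutativeMonoid
    (PermutationProperties.map⁺ ℝ-setoid ℝ-setoid p-cong perm)

  -- Treats the three cases at once; the free `a` lets each case keep its own form of the numerator.
  bound : ∀ .{{_ : NonZero pairsAt-d}} {a} xs → otherDistances ↭ xs →
          1# - sum (map p xs) ≈ a → a / pairsAt-d ≤ p d
  bound {a} xs perm eq = ≤-/ pairsAt-d
    (≤-respˡ-≈ (trans (+-congˡ (-‿cong (sum-↭ perm))) eq) (≤-transpose 1≤))

  twoOthers : ∀ .{{_ : NonZero pairsAt-d}} x y → otherDistances ↭ x ∷ y ∷ [] →
              (1# - p x - p y) / pairsAt-d ≤ p d
  twoOthers x y perm = bound (x ∷ y ∷ []) perm
    (solve 2 (λ u v → con (+ 1) :- (u :+ (v :+ con (+ 0))) := con (+ 1) :- u :- v) refl (p x) (p y))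

  oneOther : ∀ .{{_ : NonZero pairsAt-d}} x → otherDistances ↭ x ∷ [] →
             (1# - p x) / pairsAt-d ≤ p d
  oneOther x perm = bound (x ∷ []) perm (+-congˡ (-‿cong (+-identityʳ (p x))))

  noOthers : ∀ .{{_ : NonZero pairsAt-d}} → otherDistances ↭ [] → 1# / pairsAt-d ≤ p d
  noOthers perm = bound [] perm (solve 0 (con (+ 1) :- con (+ 0) := con (+ 1)) refl)

mainTheorem2 :
  (R : RealNumbers) →
  let open RealNumbers R
      open RealArithmetic R
      open Plane R
      open Colouring R
      open Permutation ℝ-setoid using (_↭_)
  in
  (c₀ : ProperColouring 4) (μ : LeftInvariantProbability R S₄×E2) →
  let open Monochromaticity c₀ μ in
  (d : ℝ) → 0# < d →
  (P : Fin 5 → Point) →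
  let open Configuration R d P
      n = pairsAt-d
  in
  Distinct →
  8 ℕ.≤ pairsAt-1-or-d →
  Σ[ n≢0 ∈ NonZero n ]
    let _/n = λ a → (a / n) {{n≢0}} in
      (∀ x y → x ≤ y → otherDistances ↭ x ∷ y ∷ [] → (1# - p x - p y) /n ≤ p d)
    × (∀ x → otherDistances ↭ x ∷ [] → (1# - p x) /n ≤ p d)
    × (otherDistances ↭ [] → 1# /n ≤ p d)
mainTheorem2 R c₀ μ d 0<d P P-distinct 8≤k =
    n≢0
  , (λ x y x≤y → twoOthers {{n≢0}} x y)
  , (λ x → oneOther {{n≢0}} x)
  , noOthers {{n≢0}}
  where
  open Inequalities R c₀ μ d P
  n≢0 : NonZero (Configuration.pairsAt-d R d P)
  n≢0 = ℕ.≢-nonZero (FivePoints.pairsAt-d≢0 R d P P-distinct 8≤k)
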